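{- Let $\overrightarrow{W}$ be a Morse sequence on a simplicial complex $K$. Then for every $p$, $\widehat{\partial}_p\circ\curlywedge_p=\curlywedge_{p-1}\circ\partial_p$ as maps $K[p]\to\widehat W[p-1]$, and $\widehat{\delta}_p\circ\curlyvee_p=\curlyvee_{p+1}\circ\delta_p$ as maps $K[p]\to\widehat W[p+1]$.
   Context: A simplicial complex $K$ is a finite collection of non-empty finite sets closed under taking non-empty subsets; $\dim\sigma=|\sigma|-1$, $K^{(p)}$ the set of $p$-simplices. A pair $(\sigma,\tau)$ with $\sigma\subsetneq\tau$ is a free pair for $K$ if $\tau$ is the only simplex other than $\sigma$ containing $\sigma$; $K$ is then an elementary expansion of $K\setminus\{\sigma,\tau\}$. If $\nu$ is a facet (maximal simplex) of $K$, $K$ is an elementary filling of $K\setminus\{\nu\}$. A Morse sequence on $K$ is a sequence $\langle\emptyset=K_0,\dots,K_k=K\rangle$ with each $K_i$ an elementary expansion or filling of $K_{i-1}$; simplices added by fillings are critical; for an expansion $K_i=K_{i-1}\cup\{\sigma,\tau\}$, $\sigma\subset\tau$, $(\sigma,\tau)$ is a regular pair, $\sigma$ lower regular, $\tau$ upper regular. $\widehat W$ is the set of critical simplices. $K[p]$ is the $\mathbb{Z}_2$-vector space of subsets of $K^{(p)}$ (sum = symmetric difference, $0=\emptyset$; $K[p]=\{0\}$ if $p<0$ or $p>\dim K$), and $\widehat W[p]=\{c\in K[p]:c\subseteq\widehat W\}$. For $\sigma\in K^{(p)}$, $\partial(\sigma)=\{\tau\in K^{(p-1)}:\tau\subset\sigma\}$,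 $\delta(\sigma)=\{\tau\in K^{(p+1)}:\sigma\subset\tau\}$; $\partial_p:K[p]\to K[p-1]$ and $\delta_p:K[p]\to K[p+1]$ are their linear extensions. The reference map $\curlywedge$ is the unique map assigning to each $p$-simplex an element of $\widehat W[p]$, with linear extension $\curlywedge_p:K[p]\to\widehat W[p]$, such that $\curlywedge(\nu)=\{\nu\}$ for critical $\nu$ and $\curlywedge(\tau)=0=\curlywedge(\partial(\tau))$ for upper regular $\tau$; the coreference map $\curlyvee$ (linear extension $\curlyvee_p$) is the unique such map with $\curlyvee(\nu)=\{\nu\}$ for critical $\nu$ and $\curlyvee(\sigma)=0=\curlyvee(\delta(\sigma))$ for lower regular $\sigma$. The linear maps $\widehat\partial_p:\widehat W[p]\to\widehat W[p-1]$ and $\widehat\delta_p:\widehat W[p]\to\widehat W[p+1]$ are defined by $\widehat\partial_p(c)=\curlywedge_{p-1}(\partial_p(c))$ and $\widehat\delta_p(c)=\curlyvee_{p+1}(\delta_p(c))$. -}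

module Defs where

open import Data.Bool using (Bool; true; false; T; _∧_; _xor_)
open import Data.Bool.Properties using () renaming (_≟_ to _≟ᵇ_)
open import Data.Empty using (⊥-elim)
open import Data.Fin using (Fin; zero; suc; inject₁; fromℕ)
open import Data.Fin.Subset using (Subset; Nonempty; _⊆_; _⊂_; ∣_∣; inside; outside)
open import Data.Fin.Subset.Properties using (_⊂?_)
open import Data.Integer using (ℤ; +_; _+_; _-_; 1ℤ)
open import Data.Integer.Properties using () renaming (_≟_ to _≟ᶻ_)
open import Data.Nat using (ℕ; zero; suc)
open import Data.Product using (_×_; _,_; ∃-syntax)
open import Data.Sum using (_⊎_)
open import Data.Vec using ([]; _∷_)
open import Data.Vec.Properties using (≡-dec)
open import Function.Bundles using (_⇔_)
open import Relation.Binary.PropositionalEquality using (_≡_; _≢_)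
open import Relation.Nullary using (¬_; Dec; yes; no)
open import Relation.Nullary.Decidable using (⌊_⌋; T?; _×-dec_)

private
  variable
    n : ℕ

-- Since a complex is a finite collection of finite sets, its vertices are taken
-- in Fin n, with n arbitrary; not every element of Fin n need be a vertex.
record Complex (n : ℕ) : Set where
  field
    member   : Subset n → Bool
    nonempty : ∀ {σ} → T (member σ) → Nonempty σ
    closed   : ∀ {σ ρ} → T (member σ) → Nonempty ρ → ρ ⊆ σ → T (member ρ)

infix 4 _∈ᴷ_

_∈ᴷ_ : Subset n → Complex n → Set
σ ∈ᴷ K = T (Complex.member K σ)

-- Integer-valued, so that K[p] makes sense for every p ∈ ℤ and is 0 out of range.
dim : Subset n → ℤ
dim σ = + ∣ σ ∣ - 1ℤ

record FreePair (K : Complex n) (σ τ : Subset n) : Set where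
  field
    lower∈ : σ ∈ᴷ K
    upper∈ : τ ∈ᴷ K
    strict : σ ⊂ τ
    only   : ∀ ρ → ρ ∈ᴷ K → σ ⊆ ρ → ρ ≢ σ → ρ ≡ τ

record Facet (K : Complex n) (ν : Subset n) : Set where
  field
    member  : ν ∈ᴷ K
    maximal : ∀ ρ → ρ ∈ᴷ K → ν ⊆ ρ → ρ ≡ ν

-- L = K ∖ {σ, τ} with (σ, τ) a free pair for K
record Expansion (L K : Complex n) (σ τ : Subset n) : Set where
  field
    free    : FreePair K σ τ
    removal : ∀ ρ → ρ ∈ᴷ L ⇔ (ρ ∈ᴷ K × ρ ≢ σ × ρ ≢ τ)

-- L = K ∖ {ν} with ν a facet of K
record Filling (L K : Complex n) (ν : Subset n) : Set where
  field
    facet   : Facet K ν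
    removal : ∀ ρ → ρ ∈ᴷ L ⇔ (ρ ∈ᴷ K × ρ ≢ ν)

record MorseSequence (K : Complex n) : Set where
  field
    len     : ℕ
    complex : Fin (suc len) → Complex n
    starts  : ∀ ρ → ¬ (ρ ∈ᴷ complex zero)
    ends    : ∀ ρ → ρ ∈ᴷ complex (fromℕ len) ⇔ ρ ∈ᴷ K
    step    : ∀ (i : Fin len) →
              (∃[ σ ] ∃[ τ ] Expansion (complex (inject₁ i)) (complex (suc i)) σ τ)
              ⊎ (∃[ ν ] Filling (complex (inject₁ i)) (complex (suc i)) ν)

module _ {K : Complex n} (W : MorseSequence K) where
  open MorseSequence W

  Critical : Subset n → Set
  Critical ν = ∃[ i ] Filling (complex (inject₁ i)) (complex (suc i)) ν

  RegularPair : Subset n → Subset n → Set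
  RegularPair σ τ = ∃[ i ] Expansion (complex (inject₁ i)) (complex (suc i)) σ τ

  LowerRegular : Subset n → Set
  LowerRegular σ = ∃[ τ ] RegularPair σ τ

  UpperRegular : Subset n → Set
  UpperRegular τ = ∃[ σ ] RegularPair σ τ

-- The set K^(p). The irrelevant field makes simplices with equal vertex sets equal,
-- so a function on Simplex K p depends on the vertex set only.
record Simplex (K : Complex n) (p : ℤ) : Set where
  constructor simplex
  field
    vertices : Subset n
    .valid   : vertices ∈ᴷ K × dim vertices ≡ p

open Simplex public using (vertices)

-- Subsets of K^(p), as characteristic functions; compared with _≈_ below.
_[_] : Complex n → ℤ → Set
K [ p ] = Simplex K p → Bool

module _ {K : Complex n} {p : ℤ} where

  infix 4 _≈_

  _≈_ : K [ p ] → K [ p ] → Set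
  c ≈ d = ∀ σ → c σ ≡ d σ

  0ᶜ : K [ p ]
  0ᶜ _ = false

  ⁅_⁆ᶜ : Simplex K p → K [ p ]
  ⁅ σ ⁆ᶜ τ = ⌊ ≡-dec _≟ᵇ_ (vertices σ) (vertices τ) ⌋

-- Sum in ℤ₂ over all subsets of Fin n.
⨁ : (Subset n → Bool) → Bool
⨁ {zero}  f = f []
⨁ {suc n} f = ⨁ (λ σ → f (outside ∷ σ)) xor ⨁ (λ σ → f (inside ∷ σ))

module _ {K : Complex n} {p : ℤ} where

  simplex? : (σ : Subset n) → Dec (σ ∈ᴷ K × dim σ ≡ p)
  simplex? σ = T? (Complex.member K σ) ×-dec (dim σ ≟ᶻ p)

  extendByZero : (Simplex K p → Bool) → Subset n → Bool
  extendByZero g σ with simplex? σ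
  ... | yes v = g (simplex σ v)
  ... | no  _ = false

  -- Sum in ℤ₂ over the p-simplices of K.
  ∑ : (Simplex K p → Bool) → Bool
  ∑ g = ⨁ (extendByZero g)

  -- f̄(c) = Σ_{σ ∈ c} f(σ), the sum being symmetric difference.
  linear : {q : ℤ} → (Simplex K p → K [ q ]) → K [ p ] → K [ q ]
  linear f c τ = ∑ (λ σ → c σ ∧ f σ τ)

  ∂ˢ : Simplex K p → K [ p - 1ℤ ]
  ∂ˢ σ τ = ⌊ vertices τ ⊂? vertices σ ⌋

  δˢ : Simplex K p → K [ p + 1ℤ ]
  δˢ σ τ = ⌊ vertices σ ⊂? vertices τ ⌋

∂ : {K : Complex n} (p : ℤ) → K [ p ] → K [ p - 1ℤ ]
∂ p = linear ∂ˢ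

δ : {K : Complex n} (p : ℤ) → K [ p ] → K [ p + 1ℤ ]
δ p = linear δˢ

-- Ŵ[p] = { c ∈ K[p] : c ⊆ Ŵ }
record Ŵ {K : Complex n} (W : MorseSequence K) (p : ℤ) : Set where
  constructor _,ᶜ_
  field
    chain    : K [ p ]
    critical : ∀ σ → T (chain σ) → Critical W (vertices σ)

open Ŵ public using (chain)

⨁-witness : (f : Subset n → Bool) → T (⨁ f) → ∃[ σ ] T (f σ)
⨁-witness {zero}  f t = [] , t
⨁-witness {suc n} f t = split _ _ t (⨁-witness _) (⨁-witness _)
  where
  split : ∀ a b → T (a xor b) →
          (T a → ∃[ σ ] T (f (outside ∷ σ))) →
          (T b → ∃[ σ ] T (f (inside ∷ σ))) → ∃[ σ ] T (f σ)
  split true  _ _ g _ with g _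
  ... | σ , u = outside ∷ σ , u
  split false b t _ h with h t
  ... | σ , u = inside ∷ σ , u

∑-witness : {K : Complex n} {p : ℤ} (g : Simplex K p → Bool) → T (∑ g) → ∃[ σ ] T (g σ)
∑-witness {K = K} {p} g t with ⨁-witness (extendByZero g) t
... | σ , u with simplex? {K = K} {p} σ
...   | yes v = simplex σ v , u
...   | no  _ = ⊥-elim u

module _ {K : Complex n} (W : MorseSequence K) where

  SimplexMap : Set
  SimplexMap = (p : ℤ) → Simplex K p → Ŵ W p

  module _ (f : SimplexMap) where

    -- The linear extension of a map from simplices to Ŵ, with values in Ŵ.
    extend : (p : ℤ) → K [ p ] → Ŵ W p
    extend p c = linear (λ σ → chain (f p σ)) c ,ᶜ λ τ t → from τ (∑-witness _ t)
      where
      from : ∀ τ → ∃[ σ ] T (c σ ∧ chain (f p σ) τ) → Critical W (vertices τ)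
      from τ (σ , u) with c σ
      ... | true  = Ŵ.critical (f p σ) τ u
      ... | false = ⊥-elim u

    -- These conditions determine f uniquely, so a statement about the reference map is
    -- stated for any f satisfying them; likewise for the coreference map.
    record IsReference : Set where
      field
        on-critical : ∀ p (ν : Simplex K p) → Critical W (vertices ν) →
                      chain (f p ν) ≈ ⁅ ν ⁆ᶜ
        on-upper    : ∀ p (τ : Simplex K p) → UpperRegular W (vertices τ) →
                      chain (f p τ) ≈ 0ᶜ × chain (extend (p - 1ℤ) (∂ˢ τ)) ≈ 0ᶜ

    record IsCoreference : Set where
      field
        on-critical : ∀ p (ν : Simplex K p) → Critical W (vertices ν) →
                      chain (f p ν) ≈ ⁅ ν ⁆ᶜ
        on-lower    : ∀ p (σ : Simplex K p) → LowerRegular W (vertices σ) →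
                      chain (f p σ) ≈ 0ᶜ × chain (extend (p + 1ℤ) (δˢ σ)) ≈ 0ᶜ

  ∂̂ : SimplexMap → (p : ℤ) → Ŵ W p → Ŵ W (p - 1ℤ)
  ∂̂ ⋏ p c = extend ⋏ (p - 1ℤ) (∂ p (chain c))

  δ̂ : SimplexMap → (p : ℤ) → Ŵ W p → Ŵ W (p + 1ℤ)
  δ̂ ⋎ p c = extend ⋎ (p + 1ℤ) (δ p (chain c))

{-# OPTIONS --safe #-}

-- Composition of linear extensions reduces the theorem to ⋏ ∂ ⋏ σ = ⋏ ∂ σ for a single
-- simplex σ.  This is immediate for σ critical (⋏ σ = σ) or upper regular (both sides
-- vanish).  For a regular pair (σ , τ), the maps ⋏ ∂ ⋏ and ⋏ ∂ both vanish on ∂ τ, the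
-- first because ⋏ ∂ τ = 0 and the second because ∂ ∂ = 0; since the faces of τ other
-- than σ enter the sequence before σ, induction along the sequence shows that the two
-- maps agree on them, hence also on σ.  The second half is dual: δ δ = 0 replaces
-- ∂ ∂ = 0, and the induction runs backwards because the cofaces of σ other than τ enter
-- the sequence after τ.
module Submission where

open import Defs
open import Data.Bool using (Bool; true; false; _∧_; _xor_)
open import Data.Bool.Properties using (∧-assoc; ∧-comm; ∧-zeroʳ; ∧-identityʳ; xor-assoc; xor-comm; xor-same; xor-identityʳ) renaming (_≟_ to _≟ᵇ_)
open import Data.Fin using (Fin; zero; suc; inject₁; fromℕ)
open import Data.Fin.Induction using (<-weakInduction; >-weakInduction)
open import Data.Fin.Subset using (Subset; _∈_; _⊆_; _⊂_; ∣_∣; _∪_; ⁅_⁆; inside; outside)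
open import Data.Fin.Subset.Properties using (_⊆?_; _⊂?_; drop-∷-⊆; s⊂s; out⊂in; ⊆-refl; ⊂-trans; ⊂-irref; p⊂q⇒∣p∣<∣q∣; p⊆p∪q; q⊆p∪q; x∈p∪q⁻; x∈⁅x⁆; x∈⁅y⁆⇒x≡y; ∪-identityʳ)
open import Data.Integer using (ℤ; +_; _+_; _-_; 1ℤ)
open import Data.Integer.Properties using (+-injective)
open import Data.Integer.Tactic.RingSolver using (solve-∀)
open import Data.Nat using (ℕ; zero; suc; _≤_; s≤s; s≤s⁻¹)
open import Data.Nat.Properties using (≤-refl; ≤-antisym; n≤1+n)
open import Data.Product using (_×_; _,_; proj₁; proj₂)
open import Data.Sum using (inj₁; inj₂)
open import Data.Vec using ([]; _∷_; here)
open import Data.Vec.Properties using (≡-dec)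
open import Function using (_∘_)
open import Function.Bundles using (Equivalence)
open import Relation.Binary.Definitions using (DecidableEquality)
open import Relation.Binary.PropositionalEquality using (_≡_; _≢_; refl; sym; trans; cong; cong₂; subst; module ≡-Reasoning)
open import Relation.Nullary using (¬_; Dec; yes; no; does; contradiction)
open import Relation.Nullary.Decidable using (⌊_⌋; dec-true; dec-false; isYes≗does; recompute)

open Equivalence using (to; from)

private
  variable
    n : ℕ

_≟_ : DecidableEquality (Subset n)
_≟_ = ≡-dec _≟ᵇ_

⌊⌋-true : ∀ {a} {A : Set a} (A? : Dec A) → A → ⌊ A? ⌋ ≡ true
⌊⌋-true A? a = trans (isYes≗does A?) (dec-true A? a)

⌊⌋-false : ∀ {a} {A : Set a} (A? : Dec A) → ¬ A → ⌊ A? ⌋ ≡ false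
⌊⌋-false A? ¬a = trans (isYes≗does A?) (dec-false A? ¬a)

⌊⌋-true⁻ : ∀ {a} {A : Set a} (A? : Dec A) → ⌊ A? ⌋ ≡ true → A
⌊⌋-true⁻ (yes a) _ = a

xor-interchange : ∀ a b c d → (a xor b) xor (c xor d) ≡ (a xor c) xor (b xor d)
xor-interchange a b c d = begin
  (a xor b) xor (c xor d) ≡⟨ xor-assoc a b (c xor d) ⟩
  a xor (b xor (c xor d)) ≡⟨ cong (a xor_) (xor-assoc b c d) ⟨
  a xor ((b xor c) xor d) ≡⟨ cong (λ x → a xor (x xor d)) (xor-comm b c) ⟩
  a xor ((c xor b) xor d) ≡⟨ cong (a xor_) (xor-assoc c b d) ⟩
  a xor (c xor (b xor d)) ≡⟨ xor-assoc a c (b xor d) ⟨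
  (a xor c) xor (b xor d) ∎
  where open ≡-Reasoning

xor≡false⇒≡ : ∀ {a b} → a xor b ≡ false → a ≡ b
xor≡false⇒≡ {true}  {true}  _ = refl
xor≡false⇒≡ {false} {false} _ = refl

-- Sums over all subsets

⨁-cong : {f g : Subset n → Bool} → (∀ σ → f σ ≡ g σ) → ⨁ f ≡ ⨁ g
⨁-cong {zero}  f≗g = f≗g []
⨁-cong {suc n} f≗g =
  cong₂ _xor_ (⨁-cong (λ σ → f≗g (outside ∷ σ))) (⨁-cong (λ σ → f≗g (inside ∷ σ)))

⨁-xor : (f g : Subset n → Bool) → ⨁ (λ σ → f σ xor g σ) ≡ ⨁ f xor ⨁ g
⨁-xor {zero}  f g = refl
⨁-xor {suc n} f g = trans
  (cong₂ _xor_ (⨁-xor (λ σ → f (outside ∷ σ)) (λ σ → g (outside ∷ σ)))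
               (⨁-xor (λ σ → f (inside ∷ σ)) (λ σ → g (inside ∷ σ))))
  (xor-interchange (⨁ (λ σ → f (outside ∷ σ))) _ _ _)

⨁-false : {f : Subset n → Bool} → (∀ σ → f σ ≡ false) → ⨁ f ≡ false
⨁-false {zero}  f≗0 = f≗0 []
⨁-false {suc n} f≗0 =
  cong₂ _xor_ (⨁-false (λ σ → f≗0 (outside ∷ σ))) (⨁-false (λ σ → f≗0 (inside ∷ σ)))

⨁-supportedAt : (f : Subset n → Bool) (ρ : Subset n) →
                (∀ σ → σ ≢ ρ → f σ ≡ false) → ⨁ f ≡ f ρ
⨁-supportedAt f [] off = refl
⨁-supportedAt f (outside ∷ ρ) off = trans
  (cong₂ _xor_
    (⨁-supportedAt _ ρ (λ σ σ≢ρ → off (outside ∷ σ) λ { refl → σ≢ρ refl }))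
    (⨁-false (λ σ → off (inside ∷ σ) λ ())))
  (xor-identityʳ _)
⨁-supportedAt f (inside ∷ ρ) off = cong₂ _xor_
  (⨁-false (λ σ → off (outside ∷ σ) λ ()))
  (⨁-supportedAt _ ρ (λ σ σ≢ρ → off (inside ∷ σ) λ { refl → σ≢ρ refl }))

-- A coordinate in `τ` but not in `ρ` is free, so the two halves of the sum coincide and cancel; one
-- in `ρ` but not in `τ` makes the interval empty; a common one leaves a single half to the
-- recursion. Since `ρ ≢ τ`, a differing coordinate is eventually met. With `does`, both tests
-- reduce on the head coordinate that `⨁` splits.
⨁-interval : {ρ τ : Subset n} → ρ ≢ τ →
             ⨁ (λ σ → does (ρ ⊆? σ) ∧ does (σ ⊆? τ)) ≡ false
⨁-interval {ρ = []} {[]} ρ≢τ = contradiction refl ρ≢τ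
⨁-interval {ρ = outside ∷ ρ} {outside ∷ τ} ρ≢τ = cong₂ _xor_
  (⨁-interval (ρ≢τ ∘ cong (outside ∷_)))
  (⨁-false (λ σ → ∧-zeroʳ (does (ρ ⊆? σ))))
⨁-interval {ρ = outside ∷ ρ} {inside ∷ τ} _ =
  xor-same (⨁ (λ σ → does (ρ ⊆? σ) ∧ does (σ ⊆? τ)))
⨁-interval {n = suc n} {inside ∷ ρ} {outside ∷ τ} _ = cong₂ _xor_
  (⨁-false {n} (λ _ → refl))
  (⨁-false (λ σ → ∧-zeroʳ (does (ρ ⊆? σ))))
⨁-interval {n = suc n} {inside ∷ ρ} {inside ∷ τ} ρ≢τ = cong₂ _xor_
  (⨁-false {n} (λ _ → refl))
  (⨁-interval (ρ≢τ ∘ cong (inside ∷_)))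

-- `⊂` carries an element of `σ` outside `ρ`; it is found at the first coordinate where the two
-- differ.
⊆∧≢⇒⊂ : {ρ σ : Subset n} → ρ ⊆ σ → ρ ≢ σ → ρ ⊂ σ
⊆∧≢⇒⊂ {ρ = []}          {[]}          ρ⊆σ ρ≢σ = contradiction refl ρ≢σ
⊆∧≢⇒⊂ {ρ = outside ∷ _} {outside ∷ _} ρ⊆σ ρ≢σ = s⊂s (⊆∧≢⇒⊂ (drop-∷-⊆ ρ⊆σ) (ρ≢σ ∘ cong (outside ∷_)))
⊆∧≢⇒⊂ {ρ = outside ∷ _} {inside ∷ _}  ρ⊆σ ρ≢σ = out⊂in (drop-∷-⊆ ρ⊆σ)
⊆∧≢⇒⊂ {ρ = inside ∷ _}  {outside ∷ _} ρ⊆σ ρ≢σ = contradiction (ρ⊆σ here) λ ()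
⊆∧≢⇒⊂ {ρ = inside ∷ _}  {inside ∷ _}  ρ⊆σ ρ≢σ = s⊂s (⊆∧≢⇒⊂ (drop-∷-⊆ ρ⊆σ) (ρ≢σ ∘ cong (inside ∷_)))

⊂-chain-false : {ρ σ τ : Subset n} → ¬ (ρ ⊂ σ × σ ⊂ τ) → ⌊ ρ ⊂? σ ⌋ ∧ ⌊ σ ⊂? τ ⌋ ≡ false
⊂-chain-false {ρ = ρ} {σ} {τ} no-chain with ρ ⊂? σ
... | no  _   = refl
... | yes ρ⊂σ = ⌊⌋-false (σ ⊂? τ) λ σ⊂τ → no-chain (ρ⊂σ , σ⊂τ)

-- The closed interval is the disjoint union of the open one and its two endpoints, which are
-- distinct because the inclusion is strict; so indicators add mod 2.
closed-interval-split : {ρ τ : Subset n} → ρ ⊂ τ → ∀ σ →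
  does (ρ ⊆? σ) ∧ does (σ ⊆? τ) ≡
  (⌊ ρ ⊂? σ ⌋ ∧ ⌊ σ ⊂? τ ⌋) xor (does (σ ≟ ρ) xor does (σ ≟ τ))
closed-interval-split {ρ = ρ} {τ} ρ⊂τ σ with σ ≟ ρ
... | yes refl
  rewrite dec-true (ρ ⊆? ρ) ⊆-refl | dec-true (ρ ⊆? τ) (proj₁ ρ⊂τ)
        | ⌊⌋-false (ρ ⊂? ρ) (⊂-irref refl) | dec-false (ρ ≟ τ) (λ ρ≡τ → ⊂-irref ρ≡τ ρ⊂τ) = refl
... | no σ≢ρ with σ ≟ τ
...   | yes refl
  rewrite dec-true (ρ ⊆? τ) (proj₁ ρ⊂τ) | dec-true (τ ⊆? τ) ⊆-refl
        | ⌊⌋-false (τ ⊂? τ) (⊂-irref refl) | ∧-zeroʳ ⌊ ρ ⊂? τ ⌋ = refl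
-- Away from the endpoints strict and non-strict inclusion agree, and both endpoint indicators are
-- `false`.
...   | no σ≢τ = trans
  (cong₂ _∧_ (does-⊆≡⌊⊂⌋ (σ≢ρ ∘ sym)) (does-⊆≡⌊⊂⌋ σ≢τ))
  (sym (xor-identityʳ _))
  where
  does-⊆≡⌊⊂⌋ : {α β : Subset _} → α ≢ β → does (α ⊆? β) ≡ ⌊ α ⊂? β ⌋
  does-⊆≡⌊⊂⌋ {α} {β} α≢β with α ⊂? β
  ... | yes α⊂β = dec-true (α ⊆? β) (proj₁ α⊂β)
  ... | no  α⊄β = dec-false (α ⊆? β) (λ α⊆β → α⊄β (⊆∧≢⇒⊂ α⊆β α≢β))

-- If ρ ⊂ τ, the open interval has 2ᵏ − 2 elements with k ≥ 1.
⨁-open-interval : (ρ τ : Subset n) → ⨁ (λ σ → ⌊ ρ ⊂? σ ⌋ ∧ ⌊ σ ⊂? τ ⌋) ≡ false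
⨁-open-interval ρ τ with ρ ⊂? τ
... | no  ρ⊄τ = ⨁-false λ σ → ⊂-chain-false {σ = σ} λ (ρ⊂σ , σ⊂τ) → ρ⊄τ (⊂-trans ρ⊂σ σ⊂τ)
... | yes ρ⊂τ = begin
  ⨁ open-interval
    -- Adjoining both endpoints changes the count by two, hence not mod 2, and yields the closed
    -- interval.
    ≡⟨ xor-identityʳ _ ⟨
  ⨁ open-interval xor (true xor true)
    ≡⟨ cong (⨁ open-interval xor_) (cong₂ _xor_ (⨁-point ρ) (⨁-point τ)) ⟨
  ⨁ open-interval xor (⨁ (λ σ → does (σ ≟ ρ)) xor ⨁ (λ σ → does (σ ≟ τ)))
    ≡⟨ cong (⨁ open-interval xor_) (⨁-xor (λ σ → does (σ ≟ ρ)) (λ σ → does (σ ≟ τ))) ⟨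
  ⨁ open-interval xor ⨁ (λ σ → does (σ ≟ ρ) xor does (σ ≟ τ))
    ≡⟨ ⨁-xor open-interval (λ σ → does (σ ≟ ρ) xor does (σ ≟ τ)) ⟨
  ⨁ (λ σ → open-interval σ xor (does (σ ≟ ρ) xor does (σ ≟ τ)))
    ≡⟨ ⨁-cong (closed-interval-split ρ⊂τ) ⟨
  ⨁ (λ σ → does (ρ ⊆? σ) ∧ does (σ ⊆? τ))
    ≡⟨ ⨁-interval (λ ρ≡τ → ⊂-irref ρ≡τ ρ⊂τ) ⟩
  false ∎
  where
  open ≡-Reasoning

  open-interval : Subset _ → Bool
  open-interval σ = ⌊ ρ ⊂? σ ⌋ ∧ ⌊ σ ⊂? τ ⌋

  ⨁-point : ∀ α → ⨁ (λ σ → does (σ ≟ α)) ≡ true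
  ⨁-point α = trans
    (⨁-supportedAt _ α (λ σ σ≢α → dec-false (σ ≟ α) σ≢α))
    (dec-true (α ≟ α) refl)

-- Sums over the simplices of a complex

module _ {K : Complex n} {p : ℤ} where

  -- The stored proof is irrelevant; decidability allows it to be recomputed for relevant use.
  valid : (σ : Simplex K p) → vertices σ ∈ᴷ K × dim (vertices σ) ≡ p
  valid (simplex σ v) = recompute (simplex? {K = K} {p} σ) v

  extendByZero-cong : {g h : Simplex K p → Bool} → (∀ σ → g σ ≡ h σ) →
                      ∀ σ → extendByZero g σ ≡ extendByZero h σ
  extendByZero-cong g≗h σ with simplex? {K = K} {p} σ
  ... | yes v = g≗h (simplex σ v)
  ... | no  _ = refl

  extendByZero-xor : (g h : Simplex K p → Bool) → ∀ σ →
    extendByZero (λ ρ → g ρ xor h ρ) σ ≡ extendByZero g σ xor extendByZero h σ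
  extendByZero-xor g h σ with simplex? {K = K} {p} σ
  ... | yes _ = refl
  ... | no  _ = refl

  ∑-cong : {g h : Simplex K p → Bool} → (∀ σ → g σ ≡ h σ) → ∑ g ≡ ∑ h
  ∑-cong g≗h = ⨁-cong (extendByZero-cong g≗h)

  ∑-xor : (g h : Simplex K p → Bool) → ∑ (λ σ → g σ xor h σ) ≡ ∑ g xor ∑ h
  ∑-xor g h = trans (⨁-cong (extendByZero-xor g h)) (⨁-xor (extendByZero g) (extendByZero h))

  ∑-false : {g : Simplex K p → Bool} → (∀ σ → g σ ≡ false) → ∑ g ≡ false
  ∑-false {g} g≗0 = ⨁-false λ σ → pointwise σ
    where
    pointwise : ∀ σ → extendByZero g σ ≡ false
    pointwise σ with simplex? {K = K} {p} σ
    ... | yes v = g≗0 (simplex σ v)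
    ... | no  _ = refl

  ∑-distribʳ : (b : Bool) (g : Simplex K p → Bool) → ∑ (λ σ → g σ ∧ b) ≡ ∑ g ∧ b
  ∑-distribʳ true  g = trans (∑-cong λ σ → ∧-identityʳ (g σ)) (sym (∧-identityʳ (∑ g)))
  ∑-distribʳ false g = trans (∑-false λ σ → ∧-zeroʳ (g σ)) (sym (∧-zeroʳ (∑ g)))

  ∑-distribˡ : (b : Bool) (g : Simplex K p → Bool) → ∑ (λ σ → b ∧ g σ) ≡ b ∧ ∑ g
  ∑-distribˡ true  g = refl
  ∑-distribˡ false g = ∑-false {λ _ → false} λ _ → refl

  ∑-supportedAt : (g : Simplex K p → Bool) (ρ : Simplex K p) →
                  (∀ σ → vertices σ ≢ vertices ρ → g σ ≡ false) → ∑ g ≡ g ρ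
  ∑-supportedAt g ρ off = trans (⨁-supportedAt (extendByZero g) (vertices ρ) off′) at
    where
    off′ : ∀ σ → σ ≢ vertices ρ → extendByZero g σ ≡ false
    off′ σ σ≢ρ with simplex? {K = K} {p} σ
    ... | yes v = off (simplex σ v) σ≢ρ
    ... | no  _ = refl

    at : extendByZero g (vertices ρ) ≡ g ρ
    at with simplex? {K = K} {p} (vertices ρ)
    ... | yes _ = refl
    ... | no ¬v = contradiction (valid ρ) ¬v

  -- Recursion on `m` splits only the sum over subsets; additivity of `∑` moves each split outside.
  ∑-⨁-swap : ∀ {m} (h : Simplex K p → Subset m → Bool) →
             ∑ (λ σ → ⨁ (h σ)) ≡ ⨁ (λ τ → ∑ (λ σ → h σ τ))
  ∑-⨁-swap {zero}  h = refl
  ∑-⨁-swap {suc m} h = trans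
    (∑-xor (λ σ → ⨁ (λ τ → h σ (outside ∷ τ))) (λ σ → ⨁ (λ τ → h σ (inside ∷ τ))))
    (cong₂ _xor_ (∑-⨁-swap (λ σ τ → h σ (outside ∷ τ))) (∑-⨁-swap (λ σ τ → h σ (inside ∷ τ))))

-- Exchange of sums and linear extensions.

module _ {K : Complex n} {p q : ℤ} where

  ∑-swap : (g : Simplex K p → Simplex K q → Bool) →
           ∑ (λ σ → ∑ (λ τ → g σ τ)) ≡ ∑ (λ τ → ∑ (λ σ → g σ τ))
  ∑-swap g = trans (∑-⨁-swap (λ σ → extendByZero (g σ))) (⨁-cong pointwise)
    where
    pointwise : ∀ τ → ∑ (λ σ → extendByZero (g σ) τ) ≡ extendByZero (λ τ → ∑ (λ σ → g σ τ)) τ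
    pointwise τ with simplex? {K = K} {q} τ
    ... | yes _ = refl
    ... | no  _ = ∑-false {K = K} {p} {λ _ → false} λ _ → refl

  linear-cong : {f g : Simplex K p → K [ q ]} → (∀ σ → f σ ≈ g σ) →
                (c : K [ p ]) → linear f c ≈ linear g c
  linear-cong f≗g c τ = ∑-cong λ σ → cong (c σ ∧_) (f≗g σ τ)

  linear-congʳ : (f : Simplex K p → K [ q ]) {c d : K [ p ]} → c ≈ d → linear f c ≈ linear f d
  linear-congʳ f c≈d τ = ∑-cong λ σ → cong (_∧ f σ τ) (c≈d σ)

  linear-zero : (f : Simplex K p → K [ q ]) {c : K [ p ]} → c ≈ 0ᶜ → linear f c ≈ 0ᶜ
  linear-zero f c≈0 τ = ∑-false λ σ → cong (_∧ f σ τ) (c≈0 σ)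

  linear-point : (f : Simplex K p → K [ q ]) (σ : Simplex K p) → linear f ⁅ σ ⁆ᶜ ≈ f σ
  linear-point f σ τ = trans
    (∑-supportedAt _ σ λ ρ ρ≢σ →
      cong (_∧ f ρ τ) (⌊⌋-false (vertices σ ≟ vertices ρ) (ρ≢σ ∘ sym)))
    (cong (_∧ f σ τ) (⌊⌋-true (vertices σ ≟ vertices σ) refl))

  -- The sum of `f` and `g` over `c` is zero, and every term other than the one at `σ` cancels. This
  -- carries commutation over to the one face or coface that the induction hypothesis does not
  -- reach.
  linear-cancel : (f g : Simplex K p → K [ q ]) {c : K [ p ]} (σ : Simplex K p) →
                  c σ ≡ true →
                  (∀ ρ → c ρ ≡ true → vertices ρ ≢ vertices σ → f ρ ≈ g ρ) →
                  linear f c ≈ linear g c → f σ ≈ g σ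
  linear-cancel f g {c} σ cσ agree fc≈gc τ = xor≡false⇒≡ (begin
    f σ τ xor g σ τ
      ≡⟨ cong (λ b → (b ∧ f σ τ) xor (b ∧ g σ τ)) cσ ⟨
    (c σ ∧ f σ τ) xor (c σ ∧ g σ τ)
      ≡⟨ ∑-supportedAt (λ ρ → (c ρ ∧ f ρ τ) xor (c ρ ∧ g ρ τ)) σ off ⟨
    ∑ (λ ρ → (c ρ ∧ f ρ τ) xor (c ρ ∧ g ρ τ))
      ≡⟨ ∑-xor (λ ρ → c ρ ∧ f ρ τ) (λ ρ → c ρ ∧ g ρ τ) ⟩
    linear f c τ xor linear g c τ
      ≡⟨ cong (_xor linear g c τ) (fc≈gc τ) ⟩
    linear g c τ xor linear g c τ
      ≡⟨ xor-same (linear g c τ) ⟩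
    false ∎)
    where
    open ≡-Reasoning

    off : ∀ ρ → vertices ρ ≢ vertices σ → (c ρ ∧ f ρ τ) xor (c ρ ∧ g ρ τ) ≡ false
    off ρ ρ≢σ with c ρ in cρ
    ... | false = refl
    ... | true  = trans (cong (_xor g ρ τ) (agree ρ cρ ρ≢σ τ)) (xor-same (g ρ τ))

-- Interchange of two finite sums. It both reduces the theorem to single simplices and regroups
-- triple composites.
linear-∘ : {K : Complex n} {p q r : ℤ} (g : Simplex K q → K [ r ]) (f : Simplex K p → K [ q ])
           (c : K [ p ]) → linear g (linear f c) ≈ linear (λ σ → linear g (f σ)) c
linear-∘ g f c τ = begin
  ∑ (λ ρ → ∑ (λ σ → c σ ∧ f σ ρ) ∧ g ρ τ)
    ≡⟨ ∑-cong (λ ρ → ∑-distribʳ (g ρ τ) (λ σ → c σ ∧ f σ ρ)) ⟨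
  ∑ (λ ρ → ∑ (λ σ → (c σ ∧ f σ ρ) ∧ g ρ τ))
    ≡⟨ ∑-swap (λ ρ σ → (c σ ∧ f σ ρ) ∧ g ρ τ) ⟩
  ∑ (λ σ → ∑ (λ ρ → (c σ ∧ f σ ρ) ∧ g ρ τ))
    ≡⟨ ∑-cong (λ σ → ∑-cong (λ ρ → ∧-assoc (c σ) (f σ ρ) (g ρ τ))) ⟩
  ∑ (λ σ → ∑ (λ ρ → c σ ∧ (f σ ρ ∧ g ρ τ)))
    ≡⟨ ∑-cong (λ σ → ∑-distribˡ (c σ) (λ ρ → f σ ρ ∧ g ρ τ)) ⟩
  ∑ (λ σ → c σ ∧ ∑ (λ ρ → f σ ρ ∧ g ρ τ)) ∎
  where open ≡-Reasoning

-- Boundary and coboundary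

dim-suc : {σ τ : Subset n} → ∣ τ ∣ ≡ suc ∣ σ ∣ → dim τ ≡ dim σ + 1ℤ
dim-suc {σ = σ} eq = trans (cong (λ k → + k - 1ℤ) eq) (shift (+ ∣ σ ∣))
  where
  shift : ∀ i → (1ℤ + i) - 1ℤ ≡ (i - 1ℤ) + 1ℤ
  shift = solve-∀

p≡p-1+1 : ∀ p → p ≡ (p - 1ℤ) + 1ℤ
p≡p-1+1 = solve-∀

p≡p+1-1 : ∀ p → p ≡ (p + 1ℤ) - 1ℤ
p≡p+1-1 = solve-∀

-- Cardinalities increase strictly along `ρ ⊂ σ ⊂ τ`, with a total gap of two.
dim-between : {ρ σ τ : Subset n} → ρ ⊂ σ → σ ⊂ τ → dim τ ≡ (dim ρ + 1ℤ) + 1ℤ → dim σ ≡ dim ρ + 1ℤ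
dim-between {ρ = ρ} {σ} {τ} ρ⊂σ σ⊂τ eq =
  dim-suc {σ = ρ} {σ} (≤-antisym (s≤s⁻¹ (subst (suc ∣ σ ∣ ≤_) ∣τ∣ (p⊂q⇒∣p∣<∣q∣ σ⊂τ))) (p⊂q⇒∣p∣<∣q∣ ρ⊂σ))
  where
  shift : ∀ i → ((i - 1ℤ + 1ℤ) + 1ℤ) + 1ℤ ≡ 1ℤ + (1ℤ + i)
  shift = solve-∀

  ∣τ∣ : ∣ τ ∣ ≡ suc (suc ∣ ρ ∣)
  -- Adding `1ℤ` undoes the shift in `dim`, leaving an equation of cardinalities.
  ∣τ∣ = +-injective (trans (p≡p-1+1 (+ ∣ τ ∣)) (trans (cong (_+ 1ℤ) eq) (shift (+ ∣ ρ ∣))))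

module _ {K : Complex n} where

  -- Every set strictly between `ρ` and `τ` is a `p`-simplex of `K`, so the sum runs over the whole
  -- open interval. The degree `p` is a variable tied by an equation so that the lemma fits both
  -- `∂∂` and `δδ`.
  ∑-between : {p : ℤ} (ρ τ : Subset n) → ρ ∈ᴷ K → τ ∈ᴷ K →
              p ≡ dim ρ + 1ℤ → dim τ ≡ (dim ρ + 1ℤ) + 1ℤ →
              ∑ {K = K} {p} (λ σ → ⌊ ρ ⊂? vertices σ ⌋ ∧ ⌊ vertices σ ⊂? τ ⌋) ≡ false
  ∑-between {p} ρ τ ρ∈K τ∈K p≡ dimτ = trans (⨁-cong pointwise) (⨁-open-interval ρ τ)
    where
    isSimplex : ∀ {σ} → ρ ⊂ σ → σ ⊂ τ → σ ∈ᴷ K × dim σ ≡ p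
    -- Closure under faces covers non-empty sets only; a vertex of `ρ` shows that `σ` is one.
    isSimplex ρ⊂σ σ⊂τ with Complex.nonempty K ρ∈K
    ... | x , x∈ρ = Complex.closed K τ∈K (x , proj₁ ρ⊂σ x∈ρ) (proj₁ σ⊂τ)
                  , trans (dim-between ρ⊂σ σ⊂τ dimτ) (sym p≡)

    pointwise : ∀ σ → extendByZero {K = K} {p} (λ σ → ⌊ ρ ⊂? vertices σ ⌋ ∧ ⌊ vertices σ ⊂? τ ⌋) σ
                    ≡ ⌊ ρ ⊂? σ ⌋ ∧ ⌊ σ ⊂? τ ⌋
    pointwise σ with simplex? {K = K} {p} σ
    ... | yes _ = refl
    ... | no ¬v = sym (⊂-chain-false λ (ρ⊂σ , σ⊂τ) → ¬v (isSimplex ρ⊂σ σ⊂τ))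

  -- The coefficient at `ρ` counts, mod 2, the simplices strictly between `ρ` and `τ`.
  ∂∂≈0 : {p : ℤ} (τ : Simplex K p) → ∂ {K = K} (p - 1ℤ) (∂ˢ τ) ≈ 0ᶜ
  ∂∂≈0 {p} τ ρ with valid τ | valid ρ
  ... | τ∈K , dimτ | ρ∈K , dimρ = trans
    (∑-cong {K = K} λ σ → ∧-comm ⌊ vertices σ ⊂? vertices τ ⌋ ⌊ vertices ρ ⊂? vertices σ ⌋)
    (∑-between (vertices ρ) (vertices τ) ρ∈K τ∈K
      q≡ (trans dimτ (trans (p≡p-1+1 p) (cong (_+ 1ℤ) q≡))))
    where
    q≡ : p - 1ℤ ≡ dim (vertices ρ) + 1ℤ
    q≡ = trans (p≡p-1+1 (p - 1ℤ)) (cong (_+ 1ℤ) (sym dimρ))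

  δδ≈0 : {p : ℤ} (ρ : Simplex K p) → δ {K = K} (p + 1ℤ) (δˢ ρ) ≈ 0ᶜ
  δδ≈0 {p} ρ τ with valid τ | valid ρ
  ... | τ∈K , dimτ | ρ∈K , dimρ = ∑-between (vertices ρ) (vertices τ) ρ∈K τ∈K
    (cong (_+ 1ℤ) (sym dimρ)) (trans dimτ (cong (λ q → (q + 1ℤ) + 1ℤ) (sym dimρ)))

-- Morse sequences

∣p∪⁅x⁆∣≤1+∣p∣ : (p : Subset n) (x : Fin n) → ∣ p ∪ ⁅ x ⁆ ∣ ≤ suc ∣ p ∣
∣p∪⁅x⁆∣≤1+∣p∣ (outside ∷ p) zero    rewrite ∪-identityʳ p = ≤-refl
∣p∪⁅x⁆∣≤1+∣p∣ (inside ∷ p)  zero    rewrite ∪-identityʳ p = n≤1+n _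
∣p∪⁅x⁆∣≤1+∣p∣ (outside ∷ p) (suc x) = ∣p∪⁅x⁆∣≤1+∣p∣ p x
∣p∪⁅x⁆∣≤1+∣p∣ (inside ∷ p)  (suc x) = s≤s (∣p∪⁅x⁆∣≤1+∣p∣ p x)

-- Freeness asks only for a strict inclusion. For `x` in `τ` but not in `σ`, the set `σ ∪ ⁅ x ⁆` is
-- a face of `τ` properly containing `σ`, so uniqueness makes it `τ`.
free-dim : {K : Complex n} {σ τ : Subset n} → FreePair K σ τ → dim τ ≡ dim σ + 1ℤ
free-dim {K = K} {σ} {τ} free with FreePair.strict free
... | σ⊂τ@(σ⊆τ , x , x∈τ , x∉σ) =
  dim-suc {σ = σ} {τ} (≤-antisym (subst (λ ρ → ∣ ρ ∣ ≤ suc ∣ σ ∣) σ∪x≡τ (∣p∪⁅x⁆∣≤1+∣p∣ σ x)) (p⊂q⇒∣p∣<∣q∣ σ⊂τ))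
  where
  x∈σ∪x = q⊆p∪q σ ⁅ x ⁆ (x∈⁅x⁆ x)

  σ∪x⊆τ : σ ∪ ⁅ x ⁆ ⊆ τ
  σ∪x⊆τ y∈ with x∈p∪q⁻ σ ⁅ x ⁆ y∈
  ... | inj₁ y∈σ = σ⊆τ y∈σ
  ... | inj₂ y∈x = subst (λ z → z ∈ τ) (sym (x∈⁅y⁆⇒x≡y x y∈x)) x∈τ

  σ∪x≡τ : σ ∪ ⁅ x ⁆ ≡ τ
  σ∪x≡τ = FreePair.only free (σ ∪ ⁅ x ⁆)
    (Complex.closed K (FreePair.upper∈ free) (x , x∈σ∪x) σ∪x⊆τ)
    (p⊆p∪q ⁅ x ⁆)
    (λ σ∪x≡σ → x∉σ (subst (λ ρ → x ∈ ρ) σ∪x≡σ x∈σ∪x))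

module _ {K : Complex n} (W : MorseSequence K) where
  open MorseSequence W

  -- Downward from the last complex: each complex arises from the next by removing simplices. It
  -- lets both members of a regular pair be viewed as simplices of `K`.
  complex⊆K : ∀ i {ρ} → ρ ∈ᴷ complex i → ρ ∈ᴷ K
  complex⊆K = >-weakInduction (λ i → ∀ {ρ} → ρ ∈ᴷ complex i → ρ ∈ᴷ K) (to (ends _)) back
    where
    back : ∀ i → (∀ {ρ} → ρ ∈ᴷ complex (suc i) → ρ ∈ᴷ K) → ∀ {ρ} → ρ ∈ᴷ complex (inject₁ i) → ρ ∈ᴷ K
    back i ih ρ∈ with step i
    ... | inj₁ (_ , _ , E) = ih (proj₁ (to (Expansion.removal E _) ρ∈))
    ... | inj₂ (_ , F)     = ih (proj₁ (to (Filling.removal F _) ρ∈))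

  -- The reference map and the boundary.

  module _ (⋏ : SimplexMap W) (isRef : IsReference W ⋏) where
    open IsReference isRef

    private
      ⋏ˢ : ∀ {p} → Simplex K p → K [ p ]
      ⋏ˢ σ = chain (⋏ _ σ)

      ∂̂⋏ ⋏∂ : ∀ {p} → Simplex K p → K [ p - 1ℤ ]
      ∂̂⋏ σ = linear ⋏ˢ (∂ _ (⋏ˢ σ))
      ⋏∂ σ = linear ⋏ˢ (∂ˢ σ)

      CommutesOn : Fin (suc len) → Set
      CommutesOn i = ∀ {p} (σ : Simplex K p) → vertices σ ∈ᴷ complex i → ∂̂⋏ σ ≈ ⋏∂ σ

      on-critical-commutes : ∀ {p} (ν : Simplex K p) → Critical W (vertices ν) → ∂̂⋏ ν ≈ ⋏∂ ν
      on-critical-commutes ν crit = linear-congʳ ⋏ˢ λ ρ → trans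
        (linear-congʳ ∂ˢ (on-critical _ ν crit) ρ) (linear-point ∂ˢ ν ρ)

      on-upper-commutes : ∀ {p} (τ : Simplex K p) → UpperRegular W (vertices τ) → ∂̂⋏ τ ≈ ⋏∂ τ
      on-upper-commutes τ up ρ = trans
        (linear-zero ⋏ˢ (linear-zero ∂ˢ (proj₁ (on-upper _ τ up))) ρ)
        (sym (proj₂ (on-upper _ τ up) ρ))

      on-∂-commutes : ∀ {p} (τ : Simplex K p) → UpperRegular W (vertices τ) →
                      linear ∂̂⋏ (∂ˢ τ) ≈ linear ⋏∂ (∂ˢ τ)
      on-∂-commutes τ up ρ = begin
        linear ∂̂⋏ (∂ˢ τ) ρ
          ≡⟨ linear-cong (λ σ → linear-∘ ⋏ˢ ∂ˢ (⋏ˢ σ)) (∂ˢ τ) ρ ⟩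
        linear (λ σ → linear ⋏∂ (⋏ˢ σ)) (∂ˢ τ) ρ
          -- Regrouping applies `⋏` to the boundary of `τ` first, where `on-upper` gives zero.
          ≡⟨ linear-∘ ⋏∂ ⋏ˢ (∂ˢ τ) ρ ⟨
        linear ⋏∂ (linear ⋏ˢ (∂ˢ τ)) ρ
          ≡⟨ linear-zero ⋏∂ (proj₂ (on-upper _ τ up)) ρ ⟩
        false
          ≡⟨ linear-zero ⋏ˢ (∂∂≈0 τ) ρ ⟨
        linear ⋏ˢ (linear ∂ˢ (∂ˢ τ)) ρ
          ≡⟨ linear-∘ ⋏ˢ ∂ˢ (∂ˢ τ) ρ ⟩
        linear ⋏∂ (∂ˢ τ) ρ ∎
        where open ≡-Reasoning

      -- The boundary of `τ` has degree `q - 1ℤ`; a separate `p` with an equation avoids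
      -- transporting `σ`, since matching on `refl` makes the degrees agree.
      on-lower-commutes : ∀ i {p q} (σ : Simplex K p) (τ : Simplex K q) → p ≡ q - 1ℤ →
                          Expansion (complex (inject₁ i)) (complex (suc i)) (vertices σ) (vertices τ) →
                          CommutesOn (inject₁ i) → ∂̂⋏ σ ≈ ⋏∂ σ
      on-lower-commutes i σ τ refl E ih = linear-cancel ∂̂⋏ ⋏∂ σ
        (⌊⌋-true (vertices σ ⊂? vertices τ) (FreePair.strict free))
        (λ ρ ρ∈∂τ ρ≢σ → ih ρ (earlier ρ (⌊⌋-true⁻ (vertices ρ ⊂? vertices τ) ρ∈∂τ) ρ≢σ))
        (on-∂-commutes τ (vertices σ , i , E))
        where
        open Expansion E

        -- All faces of `τ` lie in the complex after step `i`, and only `σ` and `τ` are new there.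
        earlier : ∀ ρ → vertices ρ ⊂ vertices τ → vertices ρ ≢ vertices σ →
                  vertices ρ ∈ᴷ complex (inject₁ i)
        earlier ρ ρ⊂τ ρ≢σ = from (removal _)
          ( Complex.closed (complex (suc i)) (FreePair.upper∈ free)
              (Complex.nonempty K (proj₁ (valid ρ))) (proj₁ ρ⊂τ)
          , ρ≢σ
          , λ ρ≡τ → ⊂-irref ρ≡τ ρ⊂τ )

      forward : ∀ i → CommutesOn (inject₁ i) → CommutesOn (suc i)
      forward i ih σ σ∈ with step i
      ... | inj₂ (ν , F) with vertices σ ≟ ν
      ...   | yes refl = on-critical-commutes σ (i , F)
      ...   | no  σ≢ν  = ih σ (from (Filling.removal F _) (σ∈ , σ≢ν))
      forward i ih σ σ∈ | inj₁ (α , β , E) with vertices σ ≟ β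
      ...   | yes refl = on-upper-commutes σ (α , i , E)
      ...   | no  σ≢β with vertices σ ≟ α
      ...     | no  σ≢α  = ih σ (from (Expansion.removal E _) (σ∈ , σ≢α , σ≢β))
      ...     | yes refl = on-lower-commutes i σ
        -- The degree is chosen as `dim β` itself, so `refl` suffices here; the chain below matches
        -- it with the degree of `σ`.
        (simplex β (complex⊆K (suc i) (FreePair.upper∈ (Expansion.free E)) , refl))
        (begin
          _                           ≡⟨ proj₂ (valid σ) ⟨
          dim (vertices σ)            ≡⟨ p≡p+1-1 _ ⟩
          dim (vertices σ) + 1ℤ - 1ℤ  ≡⟨ cong (_- 1ℤ) (free-dim (Expansion.free E)) ⟨
          dim β - 1ℤ                  ∎)
        E ih
        where open ≡-Reasoning

    ∂̂⋏≈⋏∂-simplex : ∀ {p} (σ : Simplex K p) →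
                     linear ⋏ˢ (∂ p (⋏ˢ σ)) ≈ linear ⋏ˢ (∂ˢ σ)
    ∂̂⋏≈⋏∂-simplex σ =
      -- The base case is vacuous because the first complex is empty; the last one contains every
      -- simplex of `K`.
      <-weakInduction CommutesOn (λ σ σ∈ → contradiction σ∈ (starts _)) forward
        (fromℕ len) σ (from (ends _) (proj₁ (valid σ)))

    ∂̂⋏≈⋏∂ : ∀ p (c : K [ p ]) →
             chain (∂̂ W ⋏ p (extend W ⋏ p c)) ≈ chain (extend W ⋏ (p - 1ℤ) (∂ p c))
    ∂̂⋏≈⋏∂ p c ρ = begin
      linear ⋏ˢ (linear ∂ˢ (linear ⋏ˢ c)) ρ
        ≡⟨ linear-congʳ ⋏ˢ (linear-∘ ∂ˢ ⋏ˢ c) ρ ⟩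
      linear ⋏ˢ (linear (λ σ → linear ∂ˢ (⋏ˢ σ)) c) ρ
        ≡⟨ linear-∘ ⋏ˢ (λ σ → linear ∂ˢ (⋏ˢ σ)) c ρ ⟩
      linear (λ σ → linear ⋏ˢ (linear ∂ˢ (⋏ˢ σ))) c ρ
        ≡⟨ linear-cong ∂̂⋏≈⋏∂-simplex c ρ ⟩
      linear (λ σ → linear ⋏ˢ (∂ˢ σ)) c ρ
        ≡⟨ linear-∘ ⋏ˢ ∂ˢ c ρ ⟨
      linear ⋏ˢ (linear ∂ˢ c) ρ ∎
      where open ≡-Reasoning

  -- The coreference map and the coboundary.

  module _ (⋎ : SimplexMap W) (isCoref : IsCoreference W ⋎) where
    open IsCoreference isCoref

    private
      ⋎ˢ : ∀ {p} → Simplex K p → K [ p ]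
      ⋎ˢ σ = chain (⋎ _ σ)

      δ̂⋎ ⋎δ : ∀ {p} → Simplex K p → K [ p + 1ℤ ]
      δ̂⋎ σ = linear ⋎ˢ (δ _ (⋎ˢ σ))
      ⋎δ σ = linear ⋎ˢ (δˢ σ)

      -- Concerns the simplices not yet present at stage `i`, a collection that grows as `i`
      -- decreases.
      CommutesOutside : Fin (suc len) → Set
      CommutesOutside i = ∀ {p} (σ : Simplex K p) → ¬ (vertices σ ∈ᴷ complex i) → δ̂⋎ σ ≈ ⋎δ σ

      on-critical-commutes : ∀ {p} (ν : Simplex K p) → Critical W (vertices ν) → δ̂⋎ ν ≈ ⋎δ ν
      on-critical-commutes ν crit = linear-congʳ ⋎ˢ λ ρ → trans
        (linear-congʳ δˢ (on-critical _ ν crit) ρ) (linear-point δˢ ν ρ)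

      on-lower-commutes : ∀ {p} (σ : Simplex K p) → LowerRegular W (vertices σ) → δ̂⋎ σ ≈ ⋎δ σ
      on-lower-commutes σ low ρ = trans
        (linear-zero ⋎ˢ (linear-zero δˢ (proj₁ (on-lower _ σ low))) ρ)
        (sym (proj₂ (on-lower _ σ low) ρ))

      on-δ-commutes : ∀ {p} (σ : Simplex K p) → LowerRegular W (vertices σ) →
                      linear δ̂⋎ (δˢ σ) ≈ linear ⋎δ (δˢ σ)
      on-δ-commutes σ low ρ = begin
        linear δ̂⋎ (δˢ σ) ρ
          ≡⟨ linear-cong (λ τ → linear-∘ ⋎ˢ δˢ (⋎ˢ τ)) (δˢ σ) ρ ⟩
        linear (λ τ → linear ⋎δ (⋎ˢ τ)) (δˢ σ) ρ
          ≡⟨ linear-∘ ⋎δ ⋎ˢ (δˢ σ) ρ ⟨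
        linear ⋎δ (linear ⋎ˢ (δˢ σ)) ρ
          ≡⟨ linear-zero ⋎δ (proj₂ (on-lower _ σ low)) ρ ⟩
        false
          ≡⟨ linear-zero ⋎ˢ (δδ≈0 σ) ρ ⟨
        linear ⋎ˢ (linear δˢ (δˢ σ)) ρ
          ≡⟨ linear-∘ ⋎ˢ δˢ (δˢ σ) ρ ⟩
        linear ⋎δ (δˢ σ) ρ ∎
        where open ≡-Reasoning

      on-upper-commutes : ∀ i {p q} (σ : Simplex K p) (τ : Simplex K q) → q ≡ p + 1ℤ →
                          Expansion (complex (inject₁ i)) (complex (suc i)) (vertices σ) (vertices τ) →
                          CommutesOutside (suc i) → δ̂⋎ τ ≈ ⋎δ τ
      on-upper-commutes i σ τ refl E ih = linear-cancel δ̂⋎ ⋎δ τ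
        (⌊⌋-true (vertices σ ⊂? vertices τ) (FreePair.strict free))
        (λ ρ ρ∈δσ ρ≢τ → ih ρ (later ρ (⌊⌋-true⁻ (vertices σ ⊂? vertices ρ) ρ∈δσ) ρ≢τ))
        (on-δ-commutes σ (vertices τ , i , E))
        where
        open Expansion E

        -- Were `ρ` already present after step `i`, freeness of the pair would force it to equal
        -- `τ`.
        later : ∀ ρ → vertices σ ⊂ vertices ρ → vertices ρ ≢ vertices τ →
                ¬ (vertices ρ ∈ᴷ complex (suc i))
        later ρ σ⊂ρ ρ≢τ ρ∈ =
          ρ≢τ (FreePair.only free _ ρ∈ (proj₁ σ⊂ρ) λ ρ≡σ → ⊂-irref (sym ρ≡σ) σ⊂ρ)

      -- A simplex missing before step `i` is either still missing after it, and covered by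
      -- induction, or added by that very step.
      backward : ∀ i → CommutesOutside (suc i) → CommutesOutside (inject₁ i)
      backward i ih σ σ∉ with step i
      ... | inj₂ (ν , F) with vertices σ ≟ ν
      ...   | yes refl = on-critical-commutes σ (i , F)
      ...   | no  σ≢ν  = ih σ λ σ∈ → σ∉ (from (Filling.removal F _) (σ∈ , σ≢ν))
      backward i ih σ σ∉ | inj₁ (α , β , E) with vertices σ ≟ α
      ...   | yes refl = on-lower-commutes σ (β , i , E)
      ...   | no  σ≢α with vertices σ ≟ β
      ...     | no  σ≢β  = ih σ λ σ∈ → σ∉ (from (Expansion.removal E _) (σ∈ , σ≢α , σ≢β))
      ...     | yes refl = on-upper-commutes i
        (simplex α (complex⊆K (suc i) (FreePair.lower∈ (Expansion.free E)) , refl))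
        σ
        (trans (sym (proj₂ (valid σ))) (free-dim (Expansion.free E)))
        E ih

    δ̂⋎≈⋎δ-simplex : ∀ {p} (σ : Simplex K p) →
                     linear ⋎ˢ (δ p (⋎ˢ σ)) ≈ linear ⋎ˢ (δˢ σ)
    δ̂⋎≈⋎δ-simplex σ =
      >-weakInduction CommutesOutside
        -- No simplex of `K` is missing from the last complex, while every simplex is missing from
        -- the first.
        (λ σ σ∉ → contradiction (from (ends _) (proj₁ (valid σ))) σ∉) backward
        zero σ (starts _)

    δ̂⋎≈⋎δ : ∀ p (c : K [ p ]) →
             chain (δ̂ W ⋎ p (extend W ⋎ p c)) ≈ chain (extend W ⋎ (p + 1ℤ) (δ p c))
    δ̂⋎≈⋎δ p c ρ = begin
      linear ⋎ˢ (linear δˢ (linear ⋎ˢ c)) ρ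
        ≡⟨ linear-congʳ ⋎ˢ (linear-∘ δˢ ⋎ˢ c) ρ ⟩
      linear ⋎ˢ (linear (λ σ → linear δˢ (⋎ˢ σ)) c) ρ
        ≡⟨ linear-∘ ⋎ˢ (λ σ → linear δˢ (⋎ˢ σ)) c ρ ⟩
      linear (λ σ → linear ⋎ˢ (linear δˢ (⋎ˢ σ))) c ρ
        ≡⟨ linear-cong δ̂⋎≈⋎δ-simplex c ρ ⟩
      linear (λ σ → linear ⋎ˢ (δˢ σ)) c ρ
        ≡⟨ linear-∘ ⋎ˢ δˢ c ρ ⟨
      linear ⋎ˢ (linear δˢ c) ρ ∎
      where open ≡-Reasoning

theorem4 : ∀ {n : ℕ} (K : Complex n) (W : MorseSequence K) →
    ((⋏ : SimplexMap W) → IsReference W ⋏ → (p : ℤ) (c : K [ p ]) →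
    chain (∂̂ W ⋏ p (extend W ⋏ p c)) ≈ chain (extend W ⋏ (p - 1ℤ) (∂ p c)))
    ×
    ((⋎ : SimplexMap W) → IsCoreference W ⋎ → (p : ℤ) (c : K [ p ]) →
    chain (δ̂ W ⋎ p (extend W ⋎ p c)) ≈ chain (extend W ⋎ (p + 1ℤ) (δ p c)))
theorem4 K W = ∂̂⋏≈⋏∂ W , δ̂⋎≈⋎δ W
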